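{- For $n\geq 1$, the interval $F_n$ of $(\mathscr{D}_{n+2},\leq)$ is mapped by $\rho$ to the set $Z_n\subseteq\{0,1,2\}^n$ of coordinates of (the vertices of) the Hochschild polytope of Saneblidze; that is, the image of $F_n$ by $\rho$ is $\rho(F_n)=Z_n$.
   Context: A Dyck path of size $n\geq 0$ is a word of length $2n$ in the letters $0,1$ with $n$ letters $1$ and $n$ letters $0$ such that every prefix contains at least as many $1$'s as $0$'s (the height after a prefix is its number of $1$'s minus its number of $0$'s). Let $\mathscr{D}_n$ be the set of Dyck paths of size $n$. A subpath of a Dyck path $w$ is a non-empty sequence $x$ of consecutive letters of $w$ that starts and ends at the same height and stays strictly above that height in between. A subpath $x$ is movable in $w$ if it is immediately preceded in $w$ by the letter $0$ and either $x$ ends at the last letter of $w$ or $x$ is immediately followed in $w$ by the letter $1$. For a movable subpath $x$, let $N=N(w,x)\geq 1$ be the number of consecutive letters $0$ just before $x$, so $w=a\,0^{N}\,x\,b$ where $a$ does not end with $0$; for $1\leq i\leq N$ let $M(w,x,i)=a\,0^{N-i}\,x\,0^{i}\,b\in\mathscr{D}_n$. Let $\Gamma_n$ be the directed graph on $\mathscr{D}_n$ with edges $w\to M(w,x,i)$ for all movable $x$ in $w$ and all $1\leq i\leq N(w,x)$. The dexter order is: $u\leq v$ if and only if there is a directed path (possibly of length $0$) from $u$ to $v$ in $\Gamma_n$. This is a partial order whose cover relations are exactly the edges of $\Gamma_n$. The interval $F_n$: for $n\geq 1$, $F_n$ is the interval in $\mathscr{D}_{n+2}$ between $(1,1,0,0,(1,0)^n)$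 and $(1,1^n,0^n,1,0,0)$ (these two elements are comparable). The map $\rho$: a valley of a Dyck path is an occurrence of consecutive letters $(0,1)$, and its height is the height at the point between these two letters. All elements of $F_n$ start with $(1,1)$ and all their valleys have height $0$ or $1$. For $w\in F_n$, the word $\rho(w)$ in the alphabet $\{0,1,2\}$ is defined by reading $w$ from left to right, keeping an integer $N_2$ (initially $0$) and a current word (initially empty). Each time two consecutive letters $1,1$ are read (overlapping pairs allowed, but excluding the pair formed by the first two letters of $w$), $N_2$ is increased by $1$. Each time a valley of height $h$ is read, the word $[h,2,\dots,2]$ with $N_2$ letters $2$ is appended to the current word, and $N_2$ is reset to $0$. The final current word is $\rho(w)$; it has length $n$. The set $Z_n$: define recursively sets $Z_{n,0},Z_{n,1},Z_{n,b}\subseteq\{0,1,2\}^n$ with $Z_{n,b}\subseteq Z_{n,1}$ by $Z_{1,0}=\{[0]\}$, $Z_{1,1}=Z_{1,b}=\{[1]\}$ and, for $n\geq 1$: (i) $Z_{n+1,1}$ consists of all $[z,0]$ and $[z,2]$ with $z\in Z_{n,1}$ and all $[z,1]$ with $z\in Z_{n,b}$; (ii) $Z_{n+1,b}$ consists of all $[z,1]$ and $[z,2]$ with $z\in Z_{n,b}$; (iii) $Z_{n+1,0}$ consists of the words obtained by replacing the first letter by $0$ in those elements of $Z_{n+1,1}$ in which the letter $1$ appears only as the first letter. Then $Z_n=Z_{n,0}\sqcup Z_{n,1}$ is the set of coordinates of the vertices of the Hochschild polytope of Saneblidze. -}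

module Defs where

open import Data.Fin using (Fin; toℕ; _≟_)
open import Data.Fin.Patterns using (0F; 1F; 2F)
open import Data.Integer as ℤ using (ℤ; +_)
open import Data.List using (List; []; _∷_; _++_; _∷ʳ_; concat; filter; length; map; replicate)
open import Data.Nat using (ℕ; suc; _+_; _*_; _∸_; _≤_)
open import Data.Product using (∃-syntax; _×_)
open import Data.Sum using (_⊎_)
open import Data.Vec as Vec using (Vec)
open import Data.Vec.Relation.Unary.All using (All)
open import Level using (0ℓ)
open import Relation.Binary using (Rel)
open import Relation.Binary.Construct.Closure.ReflexiveTransitive using (Star)
open import Relation.Binary.PropositionalEquality using (_≡_; _≢_)
open import Relation.Unary using (Pred; _∪_)

Word : Set
Word = List (Fin 2)

#0 #1 : Word → ℕ
#0 w = length (filter (_≟ 0F) w)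
#1 w = length (filter (_≟ 1F) w)

height : Word → ℤ
height p = + #1 p ℤ.- + #0 p

record IsDyck (n : ℕ) (w : Word) : Set where
  field
    length≡ : length w ≡ 2 * n
    ones    : #1 w ≡ n
    zeros   : #0 w ≡ n
    prefix  : ∀ p s → w ≡ p ++ s → #0 p ≤ #1 p

-- An occurrence of consecutive letters x in a word p ++ x ++ s is described
-- by the triple p , x , s; being a subpath does not depend on s.
record IsSubpath (p x : Word) : Set where
  field
    nonempty : x ≢ []
    returns  : height (p ++ x) ≡ height p
    above    : ∀ y z → x ≡ y ++ z → y ≢ [] → z ≢ [] →
               height p ℤ.< height (p ++ y)

record IsMovable (p x s : Word) : Set where
  field
    subpath  : IsSubpath p x
    preceded : ∃[ p′ ] p ≡ p′ ∷ʳ 0F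
    followed : s ≡ [] ⊎ (∃[ s′ ] s ≡ 1F ∷ s′)

-- u = a 0ᴺ x b and v = a 0ᴺ⁻ⁱ x 0ⁱ b, where a does not end with 0.
record Edge (n : ℕ) (u v : Word) : Set where
  field
    source     : IsDyck n u
    target     : IsDyck n v
    a x b      : Word
    N i        : ℕ
    a-maximal  : ∀ a′ → a ≢ a′ ∷ʳ 0F
    movable    : IsMovable (a ++ replicate N 0F) x b
    1≤i        : 1 ≤ i
    i≤N        : i ≤ N
    source≡    : u ≡ a ++ replicate N 0F ++ x ++ b
    target≡    : v ≡ a ++ replicate (N ∸ i) 0F ++ x ++ replicate i 0F ++ b

-- The dexter order. On words outside IsDyck n it only relates a word to itself.
Dexter : ℕ → Rel Word 0ℓ
Dexter n = Star (Edge n)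

bottom : ℕ → Word
bottom n = 1F ∷ 1F ∷ 0F ∷ 0F ∷ concat (replicate n (1F ∷ 0F ∷ []))

top : ℕ → Word
top n = 1F ∷ replicate n 1F ++ replicate n 0F ++ 1F ∷ 0F ∷ 0F ∷ []

F : ℕ → Pred Word 0ℓ
F n w = IsDyck (n + 2) w × Dexter (n + 2) (bottom n) w × Dexter (n + 2) w (top n)

-- In scan h N₂ c w, the letter c has just been read, h is the height after it,
-- and w remains to be read; h is thus the height of a valley c,1 when c is 0.
scan : ℤ → ℕ → Fin 2 → Word → List ℤ
scan h N₂ _  []       = []
scan h N₂ _  (0F ∷ w) = scan (ℤ.pred h) N₂ 0F w
scan h N₂ 0F (1F ∷ w) = h ∷ replicate N₂ (+ 2) ++ scan (ℤ.suc h) 0 1F w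
scan h N₂ 1F (1F ∷ w) = scan (ℤ.suc h) (suc N₂) 1F w

-- The pair formed by the first two letters is not scanned; it is 1,1 on F n, so
-- no valley is lost. The letters of ρ w are integers because a valley of an
-- arbitrary word can have any height.
ρ : Word → List ℤ
ρ (c ∷ d ∷ w) = scan (height (c ∷ d ∷ [])) 0 d w
ρ _           = []

private
  variable
    n : ℕ

-- Words in the letters 0, 1, 2; the families Z1, Zb, Z0 are empty in length 0.
mutual
  data Z1 : Pred (Vec (Fin 3) n) 0ℓ where
    [1]   : Z1 (1F Vec.∷ Vec.[])
    snoc0 : {z : Vec (Fin 3) n} → Z1 z → Z1 (z Vec.∷ʳ 0F)
    snoc2 : {z : Vec (Fin 3) n} → Z1 z → Z1 (z Vec.∷ʳ 2F)
    snoc1 : {z : Vec (Fin 3) n} → Zb z → Z1 (z Vec.∷ʳ 1F)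

  data Zb : Pred (Vec (Fin 3) n) 0ℓ where
    [1]   : Zb (1F Vec.∷ Vec.[])
    snoc1 : {z : Vec (Fin 3) n} → Zb z → Zb (z Vec.∷ʳ 1F)
    snoc2 : {z : Vec (Fin 3) n} → Zb z → Zb (z Vec.∷ʳ 2F)

data Z0 : Pred (Vec (Fin 3) n) 0ℓ where
  [0]     : Z0 (0F Vec.∷ Vec.[])
  replace : {z : Vec (Fin 3) (suc n)} → Z1 (1F Vec.∷ z) → All (_≢ 1F) z →
            Z0 (0F Vec.∷ z)

Z : (n : ℕ) → Pred (Vec (Fin 3) n) 0ℓ
Z n = Z0 ∪ Z1

letters : Vec (Fin 3) n → List ℤ
letters z = map (λ c → + toℕ c) (Vec.toList z)

Image : {A B : Set} → (A → B) → (A → Set) → B → Set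
Image f P y = ∃[ x ] P x × f x ≡ y

{-# OPTIONS --safe #-}

-- Z n consists of the words over {0,1,2} that start with 0 or 1 and have no letter 1
-- after a letter 0. Reading the number of 2s after a letter h as the number of pairs 1,1
-- in the ascent before the corresponding valley inverts ρ on the paths that start with
-- 1,1, have valleys of heights 1,…,1,0,…,0 only and end with an ascent of length 1.
-- This class of paths contains the top of F n and is closed downward along edges, because
-- raising a subpath lifts all its inner valleys to height at least 2. Conversely, on words
-- two kinds of edges suffice to go from 0ⁿ up to any element of Z n and from there to
-- 1 2ⁿ⁻¹: a 0 may become 1 when, apart from 2s, only 1s precede and only 0s follow it,
-- and a letter h may become 2 when the previous letter other than 2 is also h.

module Submission where

open import Defs
open import Data.Nat using (ℕ; _≤_)
open import Relation.Unary using (_≐_)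
open import Data.Empty using (⊥; ⊥-elim)
open import Data.Fin using (Fin; toℕ; _≟_)
open import Data.Fin.Patterns using (0F; 1F; 2F)
open import Data.Fin.Properties using (toℕ≤pred[n])
open import Data.Integer as ℤ using (ℤ; +_)
import Data.Integer.Properties as ℤₚ
open import Data.Integer.Tactic.RingSolver using (solve-∀)
open import Data.List using (List; []; _∷_; _++_; _∷ʳ_; concat; drop; filter; length; map; replicate)
open import Data.List.Properties using
  (++-assoc; ++-identityʳ; ∷-injectiveʳ; filter-++; length-++; length-replicate; map-++; map-replicate)
open import Data.Nat using (zero; suc; _+_; _∸_; _<_; z≤n; s≤s)
open import Data.Nat.Properties hiding (_≟_)
open import Data.Nat.Tactic.RingSolver using () renaming (solve-∀ to solve-∀ℕ)
open import Data.Product using (∃-syntax; _×_; _,_)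
open import Data.Sum using (_⊎_; inj₁; inj₂)
open import Function using (_∘_)
open import Relation.Binary.Construct.Closure.ReflexiveTransitive using (Star; ε; _◅_; _◅◅_; gmap)
open import Data.Vec as Vec using (Vec; toList)
open import Data.Vec.Properties using (length-toList; toList-∷ʳ)
open import Data.Vec.Relation.Unary.All as All using (All)
open import Relation.Binary.PropositionalEquality
open import Algebra.Properties.AbelianGroup ℤₚ.+-0-abelianGroup using (identityʳ-unique)

-- Letter counts and heights

zeros ones : ℕ → Word
zeros k = replicate k 0F
ones k = replicate k 1F

#0-++ : ∀ u v → #0 (u ++ v) ≡ #0 u + #0 v
#0-++ u v = trans (cong length (filter-++ (_≟ 0F) u v)) (length-++ (filter (_≟ 0F) u))

#1-++ : ∀ u v → #1 (u ++ v) ≡ #1 u + #1 v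
#1-++ u v = trans (cong length (filter-++ (_≟ 1F) u v)) (length-++ (filter (_≟ 1F) u))

#0-zeros : ∀ k → #0 (zeros k) ≡ k
#0-zeros zero    = refl
#0-zeros (suc k) = cong suc (#0-zeros k)

#1-zeros : ∀ k → #1 (zeros k) ≡ 0
#1-zeros zero    = refl
#1-zeros (suc k) = #1-zeros k

#0-ones : ∀ k → #0 (ones k) ≡ 0
#0-ones zero    = refl
#0-ones (suc k) = #0-ones k

#1-ones : ∀ k → #1 (ones k) ≡ k
#1-ones zero    = refl
#1-ones (suc k) = cong suc (#1-ones k)

#0-ones-zeros : ∀ k j → #0 (ones k ++ zeros j) ≡ j
#0-ones-zeros k j = trans (#0-++ (ones k) (zeros j)) (cong₂ _+_ (#0-ones k) (#0-zeros j))

#1-ones-zeros : ∀ k j → #1 (ones k ++ zeros j) ≡ k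
#1-ones-zeros k j = trans (#1-++ (ones k) (zeros j))
  (trans (cong₂ _+_ (#1-ones k) (#1-zeros j)) (+-identityʳ k))

height-++ : ∀ u v → height (u ++ v) ≡ height u ℤ.+ height v
height-++ u v = trans
  (cong₂ (λ m n → + m ℤ.- + n) (#1-++ u v) (#0-++ u v))
  (exchange (+ #1 u) (+ #1 v) (+ #0 u) (+ #0 v))
  where
  exchange : ∀ a b c d → (a ℤ.+ b) ℤ.- (c ℤ.+ d) ≡ (a ℤ.- c) ℤ.+ (b ℤ.- d)
  exchange = solve-∀

-- The shape of a subpath

record Prime (x : Word) : Set where
  field
    nonempty : x ≢ []
    balanced : #1 x ≡ #0 x
    above    : ∀ y z → x ≡ y ++ z → y ≢ [] → z ≢ [] → #0 y < #1 y

-- Height is additive under concatenation, so the context `p` cancels and only the letter counts of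
-- `x` remain.
subpath⇒prime : ∀ {p x} → IsSubpath p x → Prime x
subpath⇒prime {p} {x} sub = record
  { nonempty = nonempty
  ; balanced = ℤₚ.+-injective (ℤₚ.i-j≡0⇒i≡j (+ #1 x) (+ #0 x)
      (identityʳ-unique (height p) (height x) (trans (sym (height-++ p x)) returns)))
  ; above = λ y z x≡yz y≢[] z≢[] → ≰⇒> λ #1≤#0 →
      ℤₚ.<⇒≱ (subst (height p ℤ.<_) (height-++ p y) (above y z x≡yz y≢[] z≢[]))
        (subst (height p ℤ.+ height y ℤ.≤_) (ℤₚ.+-identityʳ _)
          (ℤₚ.+-monoʳ-≤ (height p) (ℤₚ.i≤j⇒i-j≤0 (ℤ.+≤+ #1≤#0))))
  }
  where open IsSubpath sub

data Runs : Word → Set where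
  peak   : ∀ k j → Runs (ones k ++ zeros j)
  valley : ∀ k j r → Runs (ones k ++ zeros (suc j) ++ 1F ∷ r)

runs : ∀ x → Runs x
runs [] = peak 0 0
runs (1F ∷ x) with runs x
... | peak k j     = peak (suc k) j
... | valley k j r = valley (suc k) j r
runs (0F ∷ x) with runs x
... | peak zero j        = peak zero (suc j)
... | peak (suc k) j     = valley 0 0 (ones k ++ zeros j)
... | valley zero j r    = valley zero (suc j) r
... | valley (suc k) j r = valley 0 0 (ones k ++ zeros (suc j) ++ 1F ∷ r)

data Shape (x : Word) : Set where
  peak   : ∀ k → x ≡ ones (suc k) ++ zeros (suc k) → Shape x
  valley : ∀ k j r → j < k → x ≡ ones (suc k) ++ zeros (suc j) ++ 1F ∷ r → Shape x

-- If there is a single ascent, balance makes its length equal to that of the descent. Otherwise the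
-- prefix ending at the first valley is proper, so this valley lies strictly above the base; this is
-- `j < k`, and it also excludes an initial 0.
prime-shape : ∀ {x} → Prime x → Shape x
prime-shape {x} pr = go (runs x) refl
  where
  open Prime pr
  not-empty : ∀ k j → ones k ++ zeros (suc j) ≢ []
  not-empty zero    j ()
  not-empty (suc k) j ()
  go : ∀ {y} → Runs y → x ≡ y → Shape x
  go (peak k j) eq with trans (sym (#1-ones-zeros k j))
      (trans (cong #1 (sym eq)) (trans balanced (trans (cong #0 eq) (#0-ones-zeros k j))))
  go (peak zero    _) eq | refl = ⊥-elim (nonempty eq)
  go (peak (suc k) _) eq | refl = peak k eq
  go (valley k j r) eq with subst₂ _<_ (#0-ones-zeros k (suc j)) (#1-ones-zeros k (suc j))
      (above (ones k ++ zeros (suc j)) (1F ∷ r)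
        (trans eq (sym (++-assoc (ones k) (zeros (suc j)) (1F ∷ r)))) (not-empty k j) λ ())
  go (valley (suc k) j r) eq | s≤s j<k = valley k j r j<k eq

-- Accepted paths

-- Acc p h m c w : the letter c has just been read, at height h; m letters 2 are
-- pending, and p is the height of the last valley. The remaining word w ends at
-- height 0, adds valleys of heights 1,…,1,0,…,0 only, and leaves nothing pending.
data Acc : Fin 2 → ℕ → ℕ → Fin 2 → Word → Set where
  end     : ∀ {p} → Acc p 0 0 0F []
  down    : ∀ {p h m c w} → Acc p h m 0F w → Acc p (suc h) m c (0F ∷ w)
  up      : ∀ {p h m w} → Acc p (suc h) (suc m) 1F w → Acc p h m 1F (1F ∷ w)
  valley1 : ∀ {m w} → Acc 1F 2 0 1F w → Acc 1F 1 m 0F (1F ∷ w)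
  valley0 : ∀ {p m w} → Acc 0F 1 0 1F w → Acc p 0 m 0F (1F ∷ w)

acc-ones : ∀ k {p h m w} → Acc p h m 1F (ones k ++ w) → Acc p (k + h) (k + m) 1F w
acc-ones zero    a      = a
acc-ones (suc k) {p} {h} {m} {w} (up a) =
  subst₂ (λ h m → Acc p h m 1F w) (+-suc k h) (+-suc k m) (acc-ones k a)

acc-ones⁻ : ∀ k {p h m w} → Acc p (k + h) (k + m) 1F w → Acc p h m 1F (ones k ++ w)
acc-ones⁻ zero    a = a
acc-ones⁻ (suc k) {p} {h} {m} {w} a =
  up (acc-ones⁻ k (subst₂ (λ h m → Acc p h m 1F w) (sym (+-suc k h)) (sym (+-suc k m)) a))

acc-zeros : ∀ j {p h m c w} → Acc p h m c (zeros (suc j) ++ w) →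
            ∃[ h′ ] h ≡ suc j + h′ × Acc p h′ m 0F w
acc-zeros zero    (down a) = _ , refl , a
acc-zeros (suc j) (down a) with acc-zeros j a
... | h′ , eq , a′ = h′ , cong suc eq , a′

acc-zeros⁻ : ∀ j {p h m c w} → Acc p h m 0F w → Acc p (suc j + h) m c (zeros (suc j) ++ w)
acc-zeros⁻ zero    a = down a
acc-zeros⁻ (suc j) a = down (acc-zeros⁻ j a)

-- The first 1 of the peak has been read already, and any pair it ends is counted in `m`; the peak
-- itself adds `k` pairs.
acc-peak : ∀ k {p h m w} → Acc p (suc h) m 1F (ones k ++ zeros (suc k) ++ w) →
           Acc p h (k + m) 0F w
acc-peak k {p} {h} {m} {w} a with acc-zeros k (acc-ones k a)
... | h′ , eq , a′ =
  subst (λ h → Acc p h (k + m) 0F w)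
    (sym (+-cancelˡ-≡ (suc k) h h′ (trans (sym (+-suc k h)) eq))) a′

acc-peak⁻ : ∀ k {p h m w} → Acc p h (k + m) 0F w →
            Acc p (suc h) m 1F (ones k ++ zeros (suc k) ++ w)
acc-peak⁻ k {p} {h} {m} {w} a = acc-ones⁻ k
  (subst (λ n → Acc p n (k + m) 1F (zeros (suc k) ++ w)) (sym (+-suc k h)) (acc-zeros⁻ k a))

-- The valley would have height `h + 1 + k - j`, which is at least 2, and no constructor accepts it.
no-high-valley : ∀ k j {p h m w} → j < k →
                 Acc p (suc (suc h)) m 1F (ones k ++ zeros (suc j) ++ 1F ∷ w) → ⊥
no-high-valley k j {h = h} j<k a with acc-zeros j (acc-ones k a)
... | .1 , eq , valley1 _ = <-irrefl (sym eq) (+-mono-≤-< j<k (s≤s (s≤s z≤n)))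
... | .0 , eq , valley0 _ = <-irrefl (sym eq) (+-mono-≤-< j<k (s≤s z≤n))

-- Downward closure of the accepted paths

Follow : Word → Set
Follow b = b ≡ [] ⊎ (∃[ b′ ] b ≡ 1F ∷ b′)

-- For `j = 0` the raised peak prolongs the preceding ascent; lowering it splits that ascent, and in
-- the code a 2 becomes the height of the valley after it. For positive `j` the valley before the
-- peak must be at height 1 and drop by one, so a code letter 1 becomes 0.
acc-lower-peak : ∀ j i k {p h m b} → Follow b →
  Acc p h m 1F (zeros j ++ 1F ∷ ones k ++ zeros (suc k) ++ zeros (suc i) ++ b) →
  Acc p h m 1F (zeros (j + suc i) ++ 1F ∷ ones k ++ zeros (suc k) ++ b)
acc-lower-peak zero i k f (up a) with acc-zeros i (acc-peak k a)
acc-lower-peak zero i k {p} {m = m} (inj₁ refl) (up a) | h′ , refl , a′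
  -- The peak would belong to a last ascent of length at least 2, leaving a positive pending count
  -- at the end.
  with subst (λ m → Acc p h′ m 0F []) (+-suc k m) a′
... | ()
acc-lower-peak zero i k (inj₂ (b , refl)) (up a) | .1 , refl , valley1 a′ =
  acc-zeros⁻ i (valley1 (acc-peak⁻ k (valley1 a′)))
acc-lower-peak zero i k (inj₂ (b , refl)) (up a) | .0 , refl , valley0 a′ =
  acc-zeros⁻ i (valley0 (acc-peak⁻ k (valley0 a′)))
acc-lower-peak (suc j) i k f a with acc-zeros j a
-- A peak standing at height 0 cannot be followed by a 0.
acc-lower-peak (suc j) i k f a | .0 , refl , valley0 a′ with acc-peak k a′
... | ()
acc-lower-peak (suc j) zero k {m = m} {b} f a | .1 , refl , valley1 a′ with acc-peak k a′
... | down a″ = subst (λ n → Acc 1F n m 1F (zeros (suc j + 1) ++ 1F ∷ ones k ++ zeros (suc k) ++ b))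
      (+-identityʳ (suc j + 1))
      (acc-zeros⁻ (j + 1) (valley0 (acc-peak⁻ k (after f a″))))
  where
  -- At height 0 the next valley, if any, is a `valley0`, which allows any previous valley height.
  after : ∀ {n} → Follow b → Acc 1F 0 n 0F b → Acc 0F 0 n 0F b
  after (inj₁ refl)       end         = end
  after (inj₂ (_ , refl)) (valley0 a) = valley0 a
acc-lower-peak (suc j) (suc i) k f a | .1 , refl , valley1 a′ with acc-peak k a′
... | down ()

-- Since `N ≤ h`, the base of the raised `x` is at height at least `i`, hence at least 1, and an
-- inner valley of `x` would be at height at least 2. So `x` is a single peak.
acc-lower : ∀ N i x {p h m b} → Prime x → Follow b → 1 ≤ i → i ≤ N → N ≤ h →
  Acc p h m 1F (zeros (N ∸ i) ++ x ++ zeros i ++ b) → Acc p h m 1F (zeros N ++ x ++ b)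
acc-lower N (suc i) x {p} {h} {m} {b} pr f _ i≤N N≤h a with prime-shape pr
... | peak k refl = subst (λ n → Acc p h m 1F (zeros n ++ x ++ b)) (m∸n+n≡m i≤N)
        (subst (λ v → Acc p h m 1F (zeros (N ∸ suc i + suc i) ++ 1F ∷ v))
          (sym (++-assoc (ones k) (zeros (suc k)) b))
          (acc-lower-peak (N ∸ suc i) i k f
            (subst (λ v → Acc p h m 1F (zeros (N ∸ suc i) ++ 1F ∷ v))
              (++-assoc (ones k) (zeros (suc k)) (zeros (suc i) ++ b)) a)))
... | valley k j r j<k refl = ⊥-elim (high (N ∸ suc i)
        (subst (_≤ h) (sym (m∸n+n≡m i≤N)) N≤h)
        (subst (λ v → Acc p h m 1F (zeros (N ∸ suc i) ++ v)) assoc a))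
  where
  w : Word
  w = r ++ zeros (suc i) ++ b
  assoc : (ones (suc k) ++ zeros (suc j) ++ 1F ∷ r) ++ zeros (suc i) ++ b
          ≡ ones (suc k) ++ zeros (suc j) ++ 1F ∷ w
  assoc = trans (++-assoc (ones (suc k)) (zeros (suc j) ++ 1F ∷ r) (zeros (suc i) ++ b))
    (cong (ones (suc k) ++_) (++-assoc (zeros (suc j)) (1F ∷ r) (zeros (suc i) ++ b)))
  high : ∀ l {h} → l + suc i ≤ h →
         Acc p h m 1F (zeros l ++ ones (suc k) ++ zeros (suc j) ++ 1F ∷ w) → ⊥
  high zero    (s≤s _) (up a) = no-high-valley k j j<k a
  high (suc l) le a with acc-zeros l a
  ... | .1 , refl , valley1 a′ = no-high-valley k j j<k a′
  ... | .0 , refl , valley0 a′ = <⇒≱ (+-monoʳ-< (suc l) (s≤s z≤n)) le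

last-letter : Fin 2 → Word → Fin 2
last-letter c []      = c
last-letter c (d ∷ w) = last-letter d w

last≡1 : ∀ c w → (∀ w′ → c ∷ w ≢ w′ ∷ʳ 0F) → last-letter c w ≡ 1F
last≡1 0F []      H = ⊥-elim (H [] refl)
last≡1 1F []      H = refl
last≡1 c  (d ∷ w) H = last≡1 d w λ w′ eq → H (c ∷ w′) (cong (c ∷_) eq)

-- The inequality says that the height after `a` is at least `N`. The replacement `f` is required in
-- all states because the state reached after `a` depends on `a`; only its last letter 1 is fixed.
acc-context : ∀ N a {X Y} →
  (∀ {p h m} → N ≤ h → Acc p h m 1F X → Acc p h m 1F Y) →
  ∀ {p h m c} → last-letter c a ≡ 1F → #0 a + N ≤ #1 a + h →
  Acc p h m c (a ++ X) → Acc p h m c (a ++ Y)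
acc-context N [] f refl le a = f le a
acc-context N (0F ∷ w) f {h = suc h} l le (down a) =
  down (acc-context N w f l (≤-pred (≤-trans le (≤-reflexive (+-suc (#1 w) h)))) a)
acc-context N (1F ∷ w) f {h = h} l le (up a) =
  up (acc-context N w f l (≤-trans le (≤-reflexive (sym (+-suc (#1 w) h)))) a)
acc-context N (1F ∷ w) f l le (valley1 a) =
  valley1 (acc-context N w f l (≤-trans le (≤-reflexive (sym (+-suc (#1 w) 1)))) a)
acc-context N (1F ∷ w) f l le (valley0 a) =
  valley0 (acc-context N w f l (≤-trans le (≤-reflexive (sym (+-suc (#1 w) 0)))) a)

Starts11 : Word → Set
Starts11 w = ∃[ w′ ] w ≡ 1F ∷ 1F ∷ w′

Accepted : Word → Set
Accepted w = ∃[ w′ ] w ≡ 1F ∷ 1F ∷ w′ × Acc 1F 2 0 1F w′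

-- As `N` is positive and the source starts with 1,1, the part `a` contains these two letters, and
-- the move leaves them in place.
edge-accepted : ∀ {n u v} → Edge n u v → Starts11 u →
                Starts11 v × (Accepted v → Accepted u)
edge-accepted record { a = [] ; N = suc _ ; source≡ = refl } (_ , ())
edge-accepted record { a = _ ∷ [] ; N = suc _ ; source≡ = refl } (_ , ())
edge-accepted record { a = [] ; N = zero ; 1≤i = s≤s _ ; i≤N = () } _
edge-accepted record { a = _ ∷ [] ; N = zero ; 1≤i = s≤s _ ; i≤N = () } _
edge-accepted record { source = source ; a = 1F ∷ 1F ∷ a ; x = x ; b = b ; N = N ; i = i
                     ; a-maximal = a-maximal ; movable = movable ; 1≤i = 1≤i ; i≤N = i≤N
                     ; source≡ = refl ; target≡ = refl } (_ , refl) =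
  (_ , refl) , λ { (_ , refl , acc) → _ , refl ,
    acc-context N a
      (acc-lower N i x (subpath⇒prime (IsMovable.subpath movable))
        (IsMovable.followed movable) 1≤i i≤N)
      (last≡1 1F (1F ∷ a) a-maximal) (≤-trans bound (≤-reflexive (+-comm 2 (#1 a)))) acc }
  where
  bound : #0 a + N ≤ 2 + #1 a
  bound = subst₂ _≤_
    (trans (#0-++ a (zeros N)) (cong (λ n → #0 a + n) (#0-zeros N)))
    (cong (suc ∘ suc) (trans (#1-++ a (zeros N)) (trans (cong (λ n → #1 a + n) (#1-zeros N)) (+-identityʳ _))))
    (IsDyck.prefix source (1F ∷ 1F ∷ a ++ zeros N) (x ++ b)
      (cong (λ w → 1F ∷ 1F ∷ w) (sym (++-assoc a (zeros N) (x ++ b)))))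

dexter-starts : ∀ {n u v} → Dexter n u v → Starts11 u → Starts11 v
dexter-starts ε       s = s
dexter-starts (e ◅ d) s with edge-accepted e s
... | s′ , _ = dexter-starts d s′

dexter-accepted : ∀ {n u v} → Dexter n u v → Starts11 u → Accepted v → Accepted u
dexter-accepted ε       s acc = acc
dexter-accepted (e ◅ d) s acc with edge-accepted e s
... | s′ , pull = pull (dexter-accepted d s′ acc)

-- Codes of accepted paths

-- Tail p t : no letter 1 of t comes after a letter 0 of p ∷ t.
data Tail : Fin 2 → List (Fin 3) → Set where
  []  : ∀ {p} → Tail p []
  two : ∀ {p t} → Tail p t → Tail p (2F ∷ t)
  zer : ∀ {p t} → Tail 0F t → Tail p (0F ∷ t)
  one : ∀ {t} → Tail 1F t → Tail 1F (1F ∷ t)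

data Code : Fin 2 → List (Fin 3) → Set where
  []  : ∀ {p} → Code p []
  zer : ∀ {p t} → Tail 0F t → Code p (0F ∷ t)
  one : ∀ {t} → Tail 1F t → Code 1F (1F ∷ t)

code⇒tail : ∀ {p t} → Code p t → Tail p t
code⇒tail []      = []
code⇒tail (zer t) = zer t
code⇒tail (one t) = one t

tail-0⇒1 : ∀ {t} → Tail 0F t → Tail 1F t
tail-0⇒1 []      = []
tail-0⇒1 (two t) = two (tail-0⇒1 t)
tail-0⇒1 (zer t) = zer t

tail-twos : ∀ m {p t} → Tail p t → Tail p (replicate m 2F ++ t)
tail-twos zero    t = t
tail-twos (suc m) t = two (tail-twos m t)

values : List (Fin 3) → List ℤ
values = map (λ c → + toℕ c)

values-twos : ∀ m t → values (replicate m 2F ++ t) ≡ replicate m (+ 2) ++ values t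
values-twos m t = trans (map-++ _ (replicate m 2F) t) (cong (_++ values t) (map-replicate _ m 2F))

length-twos : ∀ m (t : List (Fin 3)) → length (replicate m 2F ++ t) ≡ m + length t
length-twos m t = trans (length-++ (replicate m 2F)) (cong (λ n → n + length t) (length-replicate m))

-- Each 1 still to be read yields one code letter: a 2 after a 1, a valley height after a 0. Nothing
-- is lost, since no 2 is pending at the end.
acc-scan : ∀ {p h m c w} → Acc p h m c w →
           ∃[ t ] scan (+ h) m c w ≡ values t × Code p t × length t ≡ m + #1 w
acc-scan end      = [] , refl , [] , refl
acc-scan (down a) = acc-scan a
acc-scan {m = m} {w = 1F ∷ w} (up a) with acc-scan a
... | t , eq , code , len = t , eq , code , trans len (sym (+-suc m (#1 w)))
acc-scan {m = m} {w = 1F ∷ w} (valley1 a) with acc-scan a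
... | t , eq , code , len =
  1F ∷ replicate m 2F ++ t ,
  cong (+ 1 ∷_) (trans (cong (replicate m (+ 2) ++_) eq) (sym (values-twos m t))) ,
  one (tail-twos m (code⇒tail code)) ,
  trans (cong suc (trans (length-twos m t) (cong (λ n → m + n) len))) (sym (+-suc m (#1 w)))
acc-scan {m = m} {w = 1F ∷ w} (valley0 a) with acc-scan a
... | t , eq , code , len =
  0F ∷ replicate m 2F ++ t ,
  cong (+ 0 ∷_) (trans (cong (replicate m (+ 2) ++_) eq) (sym (values-twos m t))) ,
  zer (tail-twos m (code⇒tail code)) ,
  trans (cong suc (trans (length-twos m t) (cong (λ n → m + n) len))) (sym (+-suc m (#1 w)))

-- Codes and the set `Z`

toList-snoc : ∀ {n} (z : Vec (Fin 3) n) c {d t} → toList z ≡ d ∷ t →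
              toList (z Vec.∷ʳ c) ≡ d ∷ t ++ c ∷ []
toList-snoc z c eq = trans (toList-∷ʳ c z) (cong (_++ c ∷ []) eq)

-- `Zb` grows on the right while `Tail` is read from the left, so the induction carries an arbitrary
-- continuation `s`. No 0 occurs in `z`, hence `s` may contain 1s.
Zb⇒tail : ∀ {n} {z : Vec (Fin 3) n} → Zb z →
          ∃[ t ] toList z ≡ 1F ∷ t × (∀ {s} → Tail 1F s → Tail 1F (t ++ s))
Zb⇒tail [1] = [] , refl , λ s → s
Zb⇒tail (snoc1 {z = z} b) with Zb⇒tail b
... | t , eq , f = t ++ 1F ∷ [] , toList-snoc z 1F eq ,
  λ {s} ts → subst (Tail 1F) (sym (++-assoc t (1F ∷ []) s)) (f (one ts))
Zb⇒tail (snoc2 {z = z} b) with Zb⇒tail b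
... | t , eq , f = t ++ 2F ∷ [] , toList-snoc z 2F eq ,
  λ {s} ts → subst (Tail 1F) (sym (++-assoc t (2F ∷ []) s)) (f (two ts))

Z1⇒tail : ∀ {n} {z : Vec (Fin 3) n} → Z1 z →
          ∃[ t ] toList z ≡ 1F ∷ t × (∀ {s} → Tail 0F s → Tail 1F (t ++ s))
Z1⇒tail [1] = [] , refl , tail-0⇒1
Z1⇒tail (snoc0 {z = z} a) with Z1⇒tail a
... | t , eq , f = t ++ 0F ∷ [] , toList-snoc z 0F eq ,
  λ {s} ts → subst (Tail 1F) (sym (++-assoc t (0F ∷ []) s)) (f (zer ts))
Z1⇒tail (snoc2 {z = z} a) with Z1⇒tail a
... | t , eq , f = t ++ 2F ∷ [] , toList-snoc z 2F eq ,
  λ {s} ts → subst (Tail 1F) (sym (++-assoc t (2F ∷ []) s)) (f (two ts))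
Z1⇒tail (snoc1 {z = z} b) with Zb⇒tail b
... | t , eq , f = t ++ 1F ∷ [] , toList-snoc z 1F eq ,
  λ {s} ts → subst (Tail 1F) (sym (++-assoc t (1F ∷ []) s)) (f (one (tail-0⇒1 ts)))

Z1⇒code : ∀ {n} {z : Vec (Fin 3) n} → Z1 z → Code 1F (toList z)
Z1⇒code a with Z1⇒tail a
... | t , eq , f = subst (Code 1F) (sym eq) (one (subst (Tail 1F) (++-identityʳ t) (f [])))

tail-without-1 : ∀ {n} (v : Vec (Fin 3) n) → All (_≢ 1F) v → Tail 1F (toList v) → Tail 0F (toList v)
tail-without-1 Vec.[] _ _ = []
tail-without-1 (_ Vec.∷ v) (_ All.∷ ≢1) (two t) = two (tail-without-1 v ≢1 t)
tail-without-1 (_ Vec.∷ v) _            (zer t) = zer t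
tail-without-1 (_ Vec.∷ v) (1≢1 All.∷ _) (one t) = ⊥-elim (1≢1 refl)

tail-0⇒without-1 : ∀ {n} (v : Vec (Fin 3) n) → Tail 0F (toList v) → All (_≢ 1F) v
tail-0⇒without-1 Vec.[]         []      = All.[]
tail-0⇒without-1 (_ Vec.∷ v) (two t) = (λ ()) All.∷ tail-0⇒without-1 v t
tail-0⇒without-1 (_ Vec.∷ v) (zer t) = (λ ()) All.∷ tail-0⇒without-1 v t

Z⇒code : ∀ {n} {z : Vec (Fin 3) n} → Z n z → Code 1F (toList z)
Z⇒code (inj₂ z1) = Z1⇒code z1
Z⇒code (inj₁ [0]) = zer []
Z⇒code (inj₁ (replace {z = z} z1 ≢1)) with Z1⇒code z1
... | one t = zer (tail-without-1 z ≢1 t)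

Zb⊆Z1 : ∀ {n} {z : Vec (Fin 3) n} → Zb z → Z1 z
Zb⊆Z1 [1]       = [1]
Zb⊆Z1 (snoc1 b) = snoc1 b
Zb⊆Z1 (snoc2 b) = snoc2 (Zb⊆Z1 b)

-- The length `m` is existential to avoid casts along `n + length t`; it is recovered afterwards
-- from the list.
Extension : ∀ {n} → Vec (Fin 3) n → List (Fin 3) → Set
Extension z t = ∃[ m ] ∃[ z′ ] Z1 {m} z′ × toList z′ ≡ toList z ++ t

extension-∷ : ∀ {n} (z : Vec (Fin 3) n) c t → Extension (z Vec.∷ʳ c) t → Extension z (c ∷ t)
extension-∷ z c t (m , z′ , z1 , eq) = m , z′ , z1 ,
  trans eq (trans (cong (_++ t) (toList-∷ʳ c z)) (++-assoc (toList z) (c ∷ []) t))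

Z1-extension : ∀ {n} {z : Vec (Fin 3) n} {t} → Z1 z → Tail 0F t → Extension z t
Z1-extension {z = z} a []      = _ , z , a , sym (++-identityʳ _)
Z1-extension {z = z} a (two t) = extension-∷ z 2F _ (Z1-extension (snoc2 a) t)
Z1-extension {z = z} a (zer t) = extension-∷ z 0F _ (Z1-extension (snoc0 a) t)

-- `Zb` corresponds to the state `1F` of `Tail`; the first 0 passes to `Z1` and the state `0F`.
Zb-extension : ∀ {n} {z : Vec (Fin 3) n} {t} → Zb z → Tail 1F t → Extension z t
Zb-extension {z = z} b []      = _ , z , Zb⊆Z1 b , sym (++-identityʳ _)
Zb-extension {z = z} b (two t) = extension-∷ z 2F _ (Zb-extension (snoc2 b) t)
Zb-extension {z = z} b (zer t) = extension-∷ z 0F _ (Z1-extension (snoc0 (Zb⊆Z1 b)) t)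
Zb-extension {z = z} b (one t) = extension-∷ z 1F _ (Zb-extension (snoc1 b) t)

code⇒Z : ∀ {n t} → 1 ≤ n → length t ≡ n → Code 1F t → ∃[ z ] Z n z × toList z ≡ t
code⇒Z () refl []
code⇒Z 1≤n len (one t) with Zb-extension [1] t
... | suc m , _ Vec.∷ v , z1 , refl with trans (cong suc (sym (length-toList v))) len
... | refl = _ , inj₂ z1 , refl
-- The leading 0 is exchanged for 1 to build an element of `Z1`, and `replace` puts it back. Length
-- one is separate, as `replace` keeps a non-empty rest.
code⇒Z 1≤n len (zer t) with Zb-extension [1] (tail-0⇒1 t)
... | suc m , _ Vec.∷ v , z1 , refl with trans (cong suc (sym (length-toList v))) len
code⇒Z 1≤n len (zer t) | suc zero , _ Vec.∷ Vec.[] , z1 , refl | refl =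
  0F Vec.∷ Vec.[] , inj₁ [0] , refl
code⇒Z 1≤n len (zer t) | suc (suc m) , _ Vec.∷ v , z1 , refl | refl =
  0F Vec.∷ v , inj₁ (replace z1 (tail-0⇒without-1 v t)) , refl

-- Decoding words into paths

descent : Fin 2 → Fin 2 → ℕ → ℕ
-- The ascent of `c + 1` letters starts at `e`, and the descent has to end at `h`; the subtraction
-- is exact when `h ≤ e`.
descent e h c = suc ((toℕ e ∸ toℕ h) + c)

ascent : Fin 2 → Fin 2 → ℕ → Word → Word
ascent e h c w = ones (suc c) ++ zeros (descent e h c) ++ w

-- Decodes the remaining code t, at height e just before an ascent that ends in a
-- valley of height h, of which c letters 2 have been read.
run : Fin 2 → Fin 2 → ℕ → List (Fin 3) → Word
run e h c []       = ascent e h c (1F ∷ zeros (suc (toℕ h)))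
run e h c (0F ∷ t) = ascent e h c (run h 0F 0 t)
run e h c (1F ∷ t) = ascent e h c (run h 1F 0 t)
run e h c (2F ∷ t) = run e h (suc c) t

run-head : ∀ e h c t → run e h c t ≡ 1F ∷ drop 1 (run e h c t)
run-head e h c []       = refl
run-head e h c (0F ∷ t) = refl
run-head e h c (1F ∷ t) = refl
run-head e h c (2F ∷ t) = run-head e h (suc c) t

-- Here `d` counts the leading 2s of `t`. That `b` depends on neither `e` nor `c` lets the words
-- before and after a move share it.
run-ascent : ∀ h t → ∃[ d ] ∃[ b ] Follow b × (∀ e c → run e h c t ≡ ascent e h (d + c) b)
run-ascent h []       = 0 , _ , inj₂ (_ , refl) , λ e c → refl
run-ascent h (0F ∷ t) = 0 , _ , inj₂ (_ , run-head h 0F 0 t) , λ e c → refl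
run-ascent h (1F ∷ t) = 0 , _ , inj₂ (_ , run-head h 1F 0 t) , λ e c → refl
run-ascent h (2F ∷ t) with run-ascent h t
... | d , b , f , eq = suc d , b , f , λ e c →
  trans (eq e (suc c)) (cong (λ n → ascent e h n b) (+-suc d c))

-- Moves between decoded words

hump : ℕ → Word
hump k = ones (suc k) ++ zeros (suc k)

-- Edges that raise a single peak, without the Dyck conditions, so that a prefix can be added
-- freely. The factor `ones (suc l)` ensures that `N` counts the whole run of 0s.
data Move : Word → Word → Set where
  move : ∀ a l N i k b → 1 ≤ i → i ≤ N → Follow b →
         Move (a ++ ones (suc l) ++ zeros N ++ hump k ++ b)
              (a ++ ones (suc l) ++ zeros (N ∸ i) ++ hump k ++ zeros i ++ b)

move-++ : ∀ p {u v} → Move u v → Move (p ++ u) (p ++ v)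
move-++ p (move a l N i k b 1≤i i≤N f) =
  subst₂ Move (++-assoc p a _) (++-assoc p a _) (move (p ++ a) l N i k b 1≤i i≤N f)

replicate-++ : ∀ {A : Set} m n {x : A} w →
               replicate m x ++ replicate n x ++ w ≡ replicate (m + n) x ++ w
replicate-++ zero    n w = refl
replicate-++ (suc m) n w = cong (_ ∷_) (replicate-++ m n w)

hump-zeros : ∀ k i b → hump k ++ zeros i ++ b ≡ ones (suc k) ++ zeros (i + suc k) ++ b
hump-zeros k i b = trans (++-assoc (ones (suc k)) (zeros (suc k)) (zeros i ++ b))
  (cong (ones (suc k) ++_) (trans (replicate-++ (suc k) i b)
    (cong (λ n → zeros n ++ b) (+-comm (suc k) i))))

-- After its 2s, `t` ends or continues with 0, so the next peak starts and ends at height 0. Moving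
-- one 0 past it raises the valley before it to height 1.
raise-valley : ∀ {t} → Tail 0F t → ∀ c → Move (run 1F 0F c t) (run 1F 1F c t)
raise-valley []      c = move [] c (2 + c) 1 0 [] (s≤s z≤n) (s≤s z≤n) (inj₁ refl)
raise-valley (two t) c = raise-valley t (suc c)
raise-valley {0F ∷ t} (zer _) c with run-ascent 0F t
... | d , b , f , eq = subst₂ Move
  (cong (λ w → ones (suc c) ++ zeros (2 + c) ++ w)
    (trans (hump-zeros (d + 0) 0 b) (sym (eq 0F 0))))
  (cong (λ w → ones (suc c) ++ zeros (1 + c) ++ w)
    (trans (hump-zeros (d + 0) 1 b) (sym (eq 1F 0))))
  (move [] c (2 + c) 1 (d + 0) b (s≤s z≤n) (s≤s z≤n) f)

-- The next peak lies between two valleys of height `h`, or before the final valley-free descent's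
-- last peak in the same way; moving all `N` letters 0 past it joins two ascents, which turns the
-- second `h` of the code into a 2.
merge-ascents : ∀ e h c t → Move (ascent e h c (run h h 0 t)) (run e h (suc c) t)
merge-ascents e h c t with run-ascent h t
... | d , b , f , eq = subst₂ Move
  (cong (ascent e h c) (trans (hump-zeros (d + 0) 0 b) (sym source)))
  (trans target (sym (eq e (suc c))))
  (move [] c N N (d + 0) b (s≤s z≤n) ≤-refl f)
  where
  open ≡-Reasoning
  N : ℕ
  N = descent e h c
  source : run h h 0 t ≡ ones (suc (d + 0)) ++ zeros (suc (d + 0)) ++ b
  source = trans (eq h 0)
    (cong (λ n → ones (suc (d + 0)) ++ zeros (suc (n + (d + 0))) ++ b) (n∸n≡0 (toℕ h)))
  lengthen : ∀ c d → suc c + suc (d + 0) ≡ suc (d + suc c)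
  lengthen = solve-∀ℕ
  deepen : ∀ D c d → suc (D + c) + suc (d + 0) ≡ suc (D + (d + suc c))
  deepen = solve-∀ℕ
  target : ones (suc c) ++ zeros (N ∸ N) ++ hump (d + 0) ++ zeros N ++ b ≡ ascent e h (d + suc c) b
  target = begin
    ones (suc c) ++ zeros (N ∸ N) ++ hump (d + 0) ++ zeros N ++ b
      ≡⟨ cong (λ n → ones (suc c) ++ zeros n ++ hump (d + 0) ++ zeros N ++ b) (n∸n≡0 N) ⟩
    ones (suc c) ++ hump (d + 0) ++ zeros N ++ b
      ≡⟨ cong (ones (suc c) ++_) (hump-zeros (d + 0) N b) ⟩
    ones (suc c) ++ ones (suc (d + 0)) ++ zeros (N + suc (d + 0)) ++ b
      ≡⟨ replicate-++ (suc c) (suc (d + 0)) _ ⟩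
    ones (suc c + suc (d + 0)) ++ zeros (N + suc (d + 0)) ++ b
      ≡⟨ cong₂ (λ m n → ones m ++ zeros n ++ b) (lengthen c d) (deepen (toℕ e ∸ toℕ h) c d) ⟩
    ascent e h (d + suc c) b ∎

ascent-move : ∀ e h c {u v} → Move u v → Move (ascent e h c u) (ascent e h c v)
ascent-move e h c m = move-++ (ones (suc c)) (move-++ (zeros (descent e h c)) m)

ascent-moves : ∀ e h c {u v} → Star Move u v → Star Move (ascent e h c u) (ascent e h c v)
ascent-moves e h c = gmap (ascent e h c) (ascent-move e h c)

tail-zeros : ∀ k → Tail 0F (replicate k 0F)
tail-zeros zero    = []
tail-zeros (suc k) = zer (tail-zeros k)

twos-tail : ∀ k {p} → Tail p (replicate k 2F)
twos-tail zero    = []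
twos-tail (suc k) = two (twos-tail k)

-- The letters are settled from left to right, so only 0s follow whenever a valley is raised. After
-- a 1, a letter 2 is reached through 1.
from-zeros : ∀ {h t} → Tail h t → ∀ e c →
             Star Move (run e h c (replicate (length t) 0F)) (run e h c t)
from-zeros []                e c = ε
from-zeros {0F} {_ ∷ t} (two tl) e c = merge-ascents e 0F c (replicate (length t) 0F) ◅ from-zeros tl e (suc c)
from-zeros {1F} {_ ∷ t} (two tl) e c =
  ascent-move e 1F c (raise-valley (tail-zeros (length t)) 0)
    ◅ merge-ascents e 1F c (replicate (length t) 0F) ◅ from-zeros tl e (suc c)
from-zeros {h} (zer t)       e c = ascent-moves e h c (from-zeros t h 0)
from-zeros {_} {_ ∷ t} (one tl) e c =
  ascent-move e 1F c (raise-valley (tail-zeros (length t)) 0)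
    ◅ ascent-moves e 1F c (from-zeros tl 1F 0)

-- The letters are settled from right to left, so only 2s follow whenever a valley is raised or
-- ascents are merged.
to-twos : ∀ {h t} → Tail h t → ∀ e c →
          Star Move (run e h c t) (run e h c (replicate (length t) 2F))
to-twos []      e c = ε
to-twos (two t) e c = to-twos t e (suc c)
to-twos {0F} {_ ∷ t} (zer tl) e c =
  ascent-moves e 0F c (to-twos tl 0F 0) ◅◅ merge-ascents e 0F c (replicate (length t) 2F) ◅ ε
to-twos {1F} {_ ∷ t} (zer tl) e c =
  ascent-moves e 1F c (to-twos tl 1F 0)
    ◅◅ ascent-move e 1F c (raise-valley (twos-tail (length t)) 0)
    ◅ merge-ascents e 1F c (replicate (length t) 2F) ◅ ε
to-twos {_} {_ ∷ t} (one tl) e c =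
  ascent-moves e 1F c (to-twos tl 1F 0) ◅◅ merge-ascents e 1F c (replicate (length t) 2F) ◅ ε

-- Extreme paths and the scan of decoded words

bottom-run : ∀ k → bottom (suc k) ≡ 1F ∷ run 1F 0F 0 (replicate k 0F)
bottom-run zero    = refl
bottom-run (suc k) = cong (λ w → 1F ∷ 1F ∷ 0F ∷ 0F ∷ w) (sym (runs-of-zeros k))
  where
  runs-of-zeros : ∀ k → run 0F 0F 0 (replicate k 0F) ≡ concat (replicate (2 + k) (1F ∷ 0F ∷ []))
  runs-of-zeros zero    = refl
  runs-of-zeros (suc k) = cong (λ w → 1F ∷ 0F ∷ w) (runs-of-zeros k)

top-run : ∀ k → top (suc k) ≡ 1F ∷ run 1F 1F 0 (replicate k 2F)
top-run k = cong (1F ∷_) (sym (trans (run-twos k 0)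
  (cong (λ n → ones (suc n) ++ zeros (suc n) ++ 1F ∷ 0F ∷ 0F ∷ []) (+-identityʳ k))))
  where
  run-twos : ∀ k c → run 1F 1F c (replicate k 2F) ≡
             ones (suc (k + c)) ++ zeros (suc (k + c)) ++ 1F ∷ 0F ∷ 0F ∷ []
  run-twos zero    c = refl
  run-twos (suc k) c = trans (run-twos k (suc c))
    (cong (λ n → ones (suc n) ++ zeros (suc n) ++ 1F ∷ 0F ∷ 0F ∷ []) (+-suc k c))

scan-ones : ∀ k h m w → scan (+ h) m 1F (ones k ++ w) ≡ scan (+ (k + h)) (k + m) 1F w
scan-ones zero    h m w = refl
scan-ones (suc k) h m w = trans (scan-ones k (suc h) (suc m) w)
  (cong₂ (λ h m → scan (+ h) m 1F w) (+-suc k h) (+-suc k m))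

scan-zeros : ∀ j h m c w → scan (+ (suc j + h)) m c (zeros (suc j) ++ w) ≡ scan (+ h) m 0F w
scan-zeros zero    h m c w = refl
scan-zeros (suc j) h m c w = scan-zeros j h m 0F w

scan-only-zeros : ∀ j x m c → scan x m c (zeros j) ≡ []
scan-only-zeros zero    x m c = refl
scan-only-zeros (suc j) x m c = scan-only-zeros j (ℤ.pred x) m 0F

scan-ascent : ∀ {e h} c w → toℕ h ≤ toℕ e →
  scan (+ suc (toℕ e)) 0 1F (ones c ++ zeros (descent e h c) ++ 1F ∷ w) ≡
  + toℕ h ∷ replicate c (+ 2) ++ scan (+ suc (toℕ h)) 0 1F w
scan-ascent {e} {h} c w h≤e = begin
  scan (+ suc (toℕ e)) 0 1F (ones c ++ zeros (descent e h c) ++ 1F ∷ w)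
    ≡⟨ scan-ones c (suc (toℕ e)) 0 _ ⟩
  scan (+ (c + suc (toℕ e))) (c + 0) 1F (zeros (descent e h c) ++ 1F ∷ w)
    ≡⟨ cong₂ (λ n m → scan (+ n) m 1F (zeros (descent e h c) ++ 1F ∷ w)) descend (+-identityʳ c) ⟩
  scan (+ (descent e h c + toℕ h)) c 1F (zeros (descent e h c) ++ 1F ∷ w)
    ≡⟨ scan-zeros ((toℕ e ∸ toℕ h) + c) (toℕ h) c 1F _ ⟩
  + toℕ h ∷ replicate c (+ 2) ++ scan (+ suc (toℕ h)) 0 1F w ∎
  where
  open ≡-Reasoning
  shuffle : ∀ c D h → c + suc (D + h) ≡ suc (D + c + h)
  shuffle = solve-∀ℕ
  descend : c + suc (toℕ e) ≡ descent e h c + toℕ h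
  descend = trans (cong (λ n → c + suc n) (sym (m∸n+n≡m h≤e))) (shuffle c (toℕ e ∸ toℕ h) (toℕ h))

scan-run : ∀ {e h t} c → toℕ h ≤ toℕ e → Tail h t →
  scan (+ suc (toℕ e)) 0 1F (drop 1 (run e h c t)) ≡ + toℕ h ∷ replicate c (+ 2) ++ values t
scan-run {e} {h} c h≤e [] = trans (scan-ascent {e} {h} c _ h≤e)
  (cong (λ s → + toℕ h ∷ replicate c (+ 2) ++ s) (scan-only-zeros (suc (toℕ h)) (+ suc (toℕ h)) 0 1F))
scan-run {t = _ ∷ t} c h≤e (two tl) = trans (scan-run (suc c) h≤e tl) (cong (_ ∷_) (shift c))
  where
  shift : ∀ c → replicate (suc c) (+ 2) ++ values t ≡ replicate c (+ 2) ++ values (2F ∷ t)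
  shift zero    = refl
  shift (suc c) = cong (+ 2 ∷_) (shift c)
scan-run {e} {h} {_ ∷ t} c h≤e (zer tl) = trans
  (cong (λ w → scan (+ suc (toℕ e)) 0 1F (ones c ++ zeros (descent e h c) ++ w)) (run-head h 0F 0 t))
  (trans (scan-ascent {e} {h} c _ h≤e)
    (cong (λ s → + toℕ h ∷ replicate c (+ 2) ++ s) (scan-run 0 z≤n tl)))
scan-run {e} {h} {_ ∷ t} c h≤e (one tl) = trans
  (cong (λ w → scan (+ suc (toℕ e)) 0 1F (ones c ++ zeros (descent e h c) ++ w)) (run-head h 1F 0 t))
  (trans (scan-ascent {e} {h} c _ h≤e)
    (cong (λ s → + toℕ h ∷ replicate c (+ 2) ++ s) (scan-run 0 ≤-refl tl)))

-- Moves as edges between Dyck paths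

data Ballot : ℕ → Word → Set where
  []   : Ballot 0 []
  rise : ∀ {h w} → Ballot (suc h) w → Ballot h (1F ∷ w)
  fall : ∀ {h w} → Ballot h w → Ballot (suc h) (0F ∷ w)

ballot-prefix : ∀ p {s h} → Ballot h (p ++ s) → #0 p ≤ #1 p + h
ballot-prefix [] _ = z≤n
ballot-prefix (0F ∷ p) {h = suc h} (fall b) =
  ≤-trans (s≤s (ballot-prefix p b)) (≤-reflexive (sym (+-suc (#1 p) h)))
ballot-prefix (1F ∷ p) {h = h} (rise b) =
  ≤-trans (ballot-prefix p b) (≤-reflexive (+-suc (#1 p) h))

ballot-count : ∀ {h w} → Ballot h w → #0 w ≡ #1 w + h
ballot-count [] = refl
ballot-count {suc h} {0F ∷ w} (fall b) = trans (cong suc (ballot-count b)) (sym (+-suc (#1 w) h))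
ballot-count {h} {1F ∷ w} (rise b) = trans (ballot-count b) (+-suc (#1 w) h)

length-count : ∀ w → length w ≡ #1 w + #0 w
length-count []       = refl
length-count (0F ∷ w) = trans (cong suc (length-count w)) (sym (+-suc (#1 w) (#0 w)))
length-count (1F ∷ w) = cong suc (length-count w)

ballot⇒dyck : ∀ {n w} → Ballot 0 w → #1 w ≡ n → IsDyck n w
ballot⇒dyck {w = w} b refl = record
  { length≡ = trans (length-count w) (cong (λ k → #1 w + k) zeros≡)
  ; ones    = refl
  ; zeros   = trans zeros≡ (+-identityʳ (#1 w))
  ; prefix  = λ { p s refl → ≤-trans (ballot-prefix p b) (≤-reflexive (+-identityʳ (#1 p))) }
  }
  where
  zeros≡ : #0 w ≡ #1 w + 0
  zeros≡ = ballot-count b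

ballot-context : ∀ a {X Y} → (∀ {h} → Ballot h X → Ballot h Y) →
                 ∀ {h} → Ballot h (a ++ X) → Ballot h (a ++ Y)
ballot-context []       f b        = f b
ballot-context (0F ∷ a) f (fall b) = fall (ballot-context a f b)
ballot-context (1F ∷ a) f (rise b) = rise (ballot-context a f b)

ballot-zeros : ∀ j {h w} → Ballot h (zeros j ++ w) → ∃[ h′ ] h ≡ j + h′ × Ballot h′ w
ballot-zeros zero    b        = _ , refl , b
ballot-zeros (suc j) (fall b) with ballot-zeros j b
... | h′ , eq , b′ = h′ , cong suc eq , b′

ballot-zeros⁻ : ∀ j {h w} → Ballot h w → Ballot (j + h) (zeros j ++ w)
ballot-zeros⁻ zero    b = b
ballot-zeros⁻ (suc j) b = fall (ballot-zeros⁻ j b)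

ballot-ones : ∀ k {h w} → Ballot h (ones k ++ w) → Ballot (k + h) w
ballot-ones zero    b = b
ballot-ones (suc k) {h} {w} (rise b) = subst (λ n → Ballot n w) (+-suc k h) (ballot-ones k b)

ballot-ones⁻ : ∀ k {h w} → Ballot (k + h) w → Ballot h (ones k ++ w)
ballot-ones⁻ zero    b = b
ballot-ones⁻ (suc k) {h} {w} b = rise (ballot-ones⁻ k (subst (λ n → Ballot n w) (sym (+-suc k h)) b))

ballot-hump : ∀ k {h w} → Ballot h (hump k ++ w) → Ballot h w
ballot-hump k {h} {w} b
  with ballot-zeros (suc k) (ballot-ones (suc k) (subst (Ballot h) (hump-zeros k 0 w) b))
... | h′ , eq , b′ = subst (λ n → Ballot n w) (sym (+-cancelˡ-≡ (suc k) h h′ eq)) b′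

ballot-hump⁻ : ∀ k {h w} → Ballot h w → Ballot h (hump k ++ w)
ballot-hump⁻ k {h} {w} b =
  subst (Ballot h) (sym (hump-zeros k 0 w)) (ballot-ones⁻ (suc k) (ballot-zeros⁻ (suc k) b))

-- A hump returns to its starting height, so it can be inserted at any point of a descent.
move-ballot : ∀ {u v} → Move u v → Ballot 0 u → Ballot 0 v
move-ballot (move a l N i k b _ i≤N _) = ballot-context a (ballot-context (ones (suc l)) lower)
  where
  lower : ∀ {h} → Ballot h (zeros N ++ hump k ++ b) →
          Ballot h (zeros (N ∸ i) ++ hump k ++ zeros i ++ b)
  lower bal with ballot-zeros N bal
  ... | h′ , refl , bal′ = subst (λ n → Ballot n (zeros (N ∸ i) ++ hump k ++ zeros i ++ b))
    (trans (sym (+-assoc (N ∸ i) i h′)) (cong (λ n → n + h′) (m∸n+n≡m i≤N)))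
    (ballot-zeros⁻ (N ∸ i) (ballot-hump⁻ k (ballot-zeros⁻ i (ballot-hump k bal′))))

#1-++-cong : ∀ a {X Y} → #1 X ≡ #1 Y → #1 (a ++ X) ≡ #1 (a ++ Y)
#1-++-cong a {X} {Y} eq =
  trans (#1-++ a X) (trans (cong (λ n → #1 a + n) eq) (sym (#1-++ a Y)))

#1-zeros-++ : ∀ j w → #1 (zeros j ++ w) ≡ #1 w
#1-zeros-++ j w = trans (#1-++ (zeros j) w) (cong (λ n → n + #1 w) (#1-zeros j))

move-#1 : ∀ {u v} → Move u v → #1 u ≡ #1 v
move-#1 (move a l N i k b _ _ _) = #1-++-cong a (#1-++-cong (ones (suc l))
  (trans (#1-zeros-++ N _) (sym (trans (#1-zeros-++ (N ∸ i) _)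
    (#1-++-cong (hump k) (#1-zeros-++ i b))))))

not-snoc-0 : ∀ a l w′ → a ++ ones (suc l) ≢ w′ ∷ʳ 0F
not-snoc-0 a l w′ eq =
  0≢1 (trans (sym (last-snoc 1F w′)) (trans (cong (last-letter 1F) (sym eq)) (last-ones a l)))
  where
  0≢1 : Fin.zero ≢ Fin.suc (Fin.zero {0})
  0≢1 ()
  last-replicate : ∀ l → last-letter 1F (ones l) ≡ 1F
  last-replicate zero    = refl
  last-replicate (suc l) = last-replicate l
  last-ones : ∀ {c} a l → last-letter c (a ++ ones (suc l)) ≡ 1F
  last-ones []      l = last-replicate l
  last-ones (_ ∷ a) l = last-ones a l
  last-snoc : ∀ c w → last-letter c (w ∷ʳ 0F) ≡ 0F
  last-snoc c []      = refl
  last-snoc c (d ∷ w) = last-snoc d w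

zeros-snoc : ∀ a N → ∃[ p ] a ++ zeros (suc N) ≡ p ∷ʳ 0F
zeros-snoc a N = a ++ zeros N , trans (cong (a ++_) (shift N)) (sym (++-assoc a (zeros N) (0F ∷ [])))
  where
  shift : ∀ N → zeros (suc N) ≡ zeros N ++ 0F ∷ []
  shift zero    = refl
  shift (suc N) = cong (0F ∷_) (shift N)

zeros-above : ∀ j y z → zeros j ≡ y ++ z → z ≢ [] → #0 y < #1 y + j
zeros-above zero    []       _ refl z≢[] = ⊥-elim (z≢[] refl)
zeros-above zero    (_ ∷ _)  _ ()
zeros-above (suc j) []       _ _    z≢[] = s≤s z≤n
zeros-above (suc j) (0F ∷ y) z eq   z≢[] =
  ≤-trans (s≤s (zeros-above j y z (∷-injectiveʳ eq) z≢[])) (≤-reflexive (sym (+-suc (#1 y) j)))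

-- The height above the base is already `suc g`. By `j ≤ k + suc g` the descent does not pass below
-- the base, so a proper prefix stays above it.
hump-above : ∀ k j g y z → ones k ++ zeros j ≡ y ++ z → z ≢ [] → j ≤ k + suc g →
             #0 y < #1 y + suc g
hump-above zero    j g y        z eq z≢[] j≤ =
  <-≤-trans (zeros-above j y z eq z≢[]) (+-monoʳ-≤ (#1 y) j≤)
hump-above (suc k) j g []       z eq z≢[] j≤ = s≤s z≤n
hump-above (suc k) j g (1F ∷ y) z eq z≢[] j≤ =
  <-≤-trans (hump-above k j (suc g) y z (∷-injectiveʳ eq) z≢[]
              (≤-trans j≤ (≤-reflexive (sym (+-suc k (suc g))))))
            (≤-reflexive (+-suc (#1 y) (suc g)))

hump-subpath : ∀ p k → IsSubpath p (hump k)
hump-subpath p k = record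
  { nonempty = λ ()
  ; returns  = trans (height-++ p (hump k)) (trans (cong (λ h → height p ℤ.+ h) level) (ℤₚ.+-identityʳ _))
  ; above    = above
  }
  where
  level : height (hump k) ≡ + 0
  level = trans
    (cong₂ (λ m n → + m ℤ.- + n) (#1-ones-zeros (suc k) (suc k)) (#0-ones-zeros (suc k) (suc k)))
    (ℤₚ.+-inverseʳ (+ suc k))
  above : ∀ y z → hump k ≡ y ++ z → y ≢ [] → z ≢ [] → height p ℤ.< height (p ++ y)
  above [] _ _ y≢[] _ = ⊥-elim (y≢[] refl)
  above (1F ∷ y) z eq _ z≢[] = subst₂ ℤ._<_ (ℤₚ.+-identityʳ (height p)) (sym (height-++ p (1F ∷ y)))
    (ℤₚ.+-monoʳ-< (height p)
      (subst (ℤ._< height (1F ∷ y)) (ℤₚ.+-inverseʳ (+ #0 y))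
        (ℤₚ.+-monoˡ-< (ℤ.- (+ #0 y)) (ℤ.+<+ (<-≤-trans
          (hump-above k (suc k) 0 y z (∷-injectiveʳ eq) z≢[] (≤-reflexive (+-comm 1 k)))
          (≤-reflexive (+-comm (#1 y) 1)))))))

move-edge : ∀ {n u v} → IsDyck n u → IsDyck n v → Move u v → Edge n u v
move-edge dyck-u dyck-v (move a l (suc N) i k b 1≤i i≤N f) = record
  { source    = dyck-u
  ; target    = dyck-v
  ; a         = a ++ ones (suc l)
  ; x         = hump k
  ; b         = b
  ; N         = suc N
  ; i         = i
  ; a-maximal = not-snoc-0 a l
  ; movable   = record
    { subpath  = hump-subpath _ k
    ; preceded = zeros-snoc (a ++ ones (suc l)) N
    ; followed = f
    }
  ; 1≤i       = 1≤i
  ; i≤N       = i≤N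
  ; source≡   = sym (++-assoc a (ones (suc l)) _)
  ; target≡   = sym (++-assoc a (ones (suc l)) _)
  }
move-edge _ _ (move _ _ zero _ _ _ (s≤s _) () _)

moves-dexter : ∀ {n u v} → Ballot 0 u → #1 u ≡ n → Star Move u v → Dexter n u v
moves-dexter b c ε        = ε
moves-dexter b c (m ◅ ms) =
  move-edge (ballot⇒dyck b c) (ballot⇒dyck b′ c′) m ◅ moves-dexter b′ c′ ms
  where
  b′ = move-ballot m b
  c′ = trans (sym (move-#1 m)) c

moves-ballot : ∀ {u v} → Star Move u v → Ballot 0 u → Ballot 0 v
moves-ballot ε        b = b
moves-ballot (m ◅ ms) b = moves-ballot ms (move-ballot m b)

moves-#1 : ∀ {u v} → Star Move u v → #1 u ≡ #1 v
moves-#1 ε        = refl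
moves-#1 (m ◅ ms) = trans (move-#1 m) (moves-#1 ms)

ballot-bottom : ∀ n → Ballot 0 (bottom n)
ballot-bottom n = rise (rise (fall (fall (teeth n))))
  where
  teeth : ∀ n → Ballot 0 (concat (replicate n (1F ∷ 0F ∷ [])))
  teeth zero    = []
  teeth (suc n) = rise (fall (teeth n))

#1-bottom : ∀ n → #1 (bottom n) ≡ n + 2
#1-bottom n = trans (cong (λ k → 2 + k) (teeth n)) (+-comm 2 n)
  where
  teeth : ∀ n → #1 (concat (replicate n (1F ∷ 0F ∷ []))) ≡ n
  teeth zero    = refl
  teeth (suc n) = cong suc (teeth n)

-- The two inclusions

top-accepted : ∀ {n} → 1 ≤ n → Accepted (top n)
top-accepted {suc n} _ = _ , refl , acc-peak⁻ n (valley1 (down (down end)))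

-- The lower bound of the interval forces the initial 1,1; acceptance descends from the upper bound.
F⇒code : ∀ {n w} → 1 ≤ n → F n w → ∃[ t ] ρ w ≡ values t × Code 1F t × length t ≡ n
F⇒code {n} 1≤n (dyck , bottom≤w , w≤top)
  with dexter-accepted w≤top (dexter-starts bottom≤w (_ , refl)) (top-accepted 1≤n)
... | w′ , refl , acc with acc-scan acc
... | t , eq , code , len = t , eq , code , trans len
  -- Of the `n + 2` letters 1, the first two give no code letter.
  (suc-injective (suc-injective (trans (IsDyck.ones dyck) (+-comm n 2))))

from-bottom : ∀ {n t} → length t ≡ n → ∀ {h} → Tail h t →
              Star Move (bottom (suc n)) (1F ∷ run 1F h 0 t)
from-bottom {n} {t} refl {0F} tl = subst (λ u → Star Move u (1F ∷ run 1F 0F 0 t)) (sym (bottom-run n))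
  (gmap (1F ∷_) (move-++ (1F ∷ [])) (from-zeros tl 1F 0))
from-bottom {n} {t} refl {1F} tl = subst (λ u → Star Move u (1F ∷ run 1F 1F 0 t)) (sym (bottom-run n))
  (gmap (1F ∷_) (move-++ (1F ∷ [])) (raise-valley (tail-zeros n) 0 ◅ from-zeros tl 1F 0))

to-top : ∀ {n t} → length t ≡ n → ∀ {h} → Tail h t →
         Star Move (1F ∷ run 1F h 0 t) (top (suc n))
to-top {n} {t} refl {0F} tl = subst (Star Move (1F ∷ run 1F 0F 0 t)) (sym (top-run n))
  -- The first code letter is not part of `t`: a 0 there is raised last, once only 2s follow.
  (gmap (1F ∷_) (move-++ (1F ∷ [])) (to-twos tl 1F 0 ◅◅ raise-valley (twos-tail n) 0 ◅ ε))
to-top {n} {t} refl {1F} tl = subst (Star Move (1F ∷ run 1F 1F 0 t)) (sym (top-run n))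
  (gmap (1F ∷_) (move-++ (1F ∷ [])) (to-twos tl 1F 0))

run-F : ∀ {n h t} → length t ≡ n → Tail h t → F (suc n) (1F ∷ run 1F h 0 t)
run-F {n} len tl =
  ballot⇒dyck ballot count ,
  moves-dexter (ballot-bottom (suc n)) (#1-bottom (suc n)) up≤ ,
  moves-dexter ballot count (to-top len tl)
  where
  up≤ = from-bottom len tl
  ballot = moves-ballot up≤ (ballot-bottom (suc n))
  count = trans (sym (moves-#1 up≤)) (#1-bottom (suc n))

-- The initial 1 outside the run makes it start at height 1, hence `e = 1F`; the pair formed with
-- the next 1 is the one `ρ` does not count.
ρ-run : ∀ {h t} → Tail h t → ρ (1F ∷ run 1F h 0 t) ≡ + toℕ h ∷ values t
ρ-run {h} {t} tl = trans (cong (λ w → ρ (1F ∷ w)) (run-head 1F h 0 t)) (scan-run 0 (toℕ≤pred[n] h) tl)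

code⇒F : ∀ {n t} → 1 ≤ n → length t ≡ n → Code 1F t → Image ρ (F n) (values t)
code⇒F () refl []
code⇒F 1≤n refl (zer tl) = _ , run-F refl tl , ρ-run tl
code⇒F 1≤n refl (one tl) = _ , run-F refl tl , ρ-run tl

theorem9p17 : (n : ℕ) → 1 ≤ n → Image ρ (F n) ≐ Image letters (Z n)
theorem9p17 n 1≤n = F⊆Z , Z⊆F
  where
  F⊆Z : ∀ {y} → Image ρ (F n) y → Image letters (Z n) y
  F⊆Z (w , w∈F , refl) with F⇒code 1≤n w∈F
  ... | t , ρ≡ , code , len with code⇒Z 1≤n len code
  ... | z , z∈Z , z≡ = z , z∈Z , trans (cong values z≡) (sym ρ≡)
  Z⊆F : ∀ {y} → Image letters (Z n) y → Image ρ (F n) y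
  Z⊆F (z , z∈Z , refl) = code⇒F 1≤n (length-toList z) (Z⇒code z∈Z)
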